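{- Let $p\ge 3$ be prime and $q=p^r>3$. Then for every $n\ge 1$ there exists a local permutation polynomial $f\in\mathbb{F}_q[x_1,\dots,x_n]$ of degree $n(q-2)$.
   Context: $\mathbb{F}_q$ is the finite field with $q$ elements. A polynomial $f\in\mathbb{F}_q[x_1,\dots,x_n]$ is a local permutation polynomial (LPP) if, for each $i$ and each choice of the other coordinates $(a_j)_{j\ne i}\in\mathbb{F}_q^{n-1}$, the univariate polynomial in $x_i$ obtained by fixing $x_j=a_j$ for $j\ne i$ induces a bijection of $\mathbb{F}_q$. Polynomials are reduced (degree $<q$ in each variable), and degree means total degree. -}

module Defs where

open import Algebra.Bundles using (CommutativeRing)
import Algebra.Definitions as AlgebraDefinitions
import Algebra.Properties.Semiring.Exp as Exp
import Algebra.Properties.Semiring.Sum as Sum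
open import Data.Fin.Base using (Fin; toℕ)
open import Data.Nat.Base using (ℕ; zero; suc; _≤_)
open import Data.Product.Base using (_×_; ∃-syntax)
open import Data.Unit.Polymorphic.Base using (⊤)
import Data.Vec.Base as Vec
open Vec using (Vec; []; _∷_; insertAt)
open import Function.Bundles using (Inverse)
open import Function.Definitions using (Bijective)
open import Level using (Level; _⊔_)
open import Relation.Binary.PropositionalEquality using (_≡_; setoid)

private
  variable
    c ℓ : Level

-- The standard library's only fields are Heyting fields; a finite field has
-- decidable equality, so the usual definition is used and no separate
-- apartness relation is carried.
record IsFiniteField (R : CommutativeRing c ℓ) (q : ℕ) : Set (c ⊔ ℓ) where
  open CommutativeRing R hiding (setoid)
  open AlgebraDefinitions _≈_ using (Invertible)
  field
    1≉0         : 1# ≉ 0#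
    invertible  : ∀ x → x ≉ 0# → Invertible 1# _*_ x
    enumeration : Inverse (setoid (Fin q)) (CommutativeRing.setoid R)

module ReducedPolynomials (R : CommutativeRing c ℓ) (q : ℕ) where
  open CommutativeRing R hiding (setoid)
  open Exp semiring using (_^_)
  open Sum semiring using (sum)

  -- The exponents of x₁, …, xₙ in a monomial, each < q.
  Exponents : ℕ → Set
  Exponents n = Vec (Fin q) n

  totalDegree : ∀ {n} → Exponents n → ℕ
  totalDegree e = Vec.sum (Vec.map toℕ e)

  -- A reduced polynomial in n variables, given by its coefficients.
  Poly : ℕ → Set c
  Poly n = Exponents n → Carrier

  HasDegree : ∀ {n} → Poly n → ℕ → Set ℓ
  HasDegree f d =
    (∃[ e ] f e ≉ 0# × totalDegree e ≡ d) ×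
    (∀ e → f e ≉ 0# → totalDegree e ≤ d)

  sumExponents : ∀ n → (Exponents n → Carrier) → Carrier
  sumExponents zero    g = g []
  sumExponents (suc n) g = sum (λ k → sumExponents n (λ e → g (k ∷ e)))

  monomial : ∀ {n} → Exponents n → Vec Carrier n → Carrier
  monomial []      []      = 1#
  monomial (k ∷ e) (a ∷ as) = a ^ toℕ k * monomial e as

  UnivariatePoly : Set c
  UnivariatePoly = Fin q → Carrier

  evalUnivariate : UnivariatePoly → Carrier → Carrier
  evalUnivariate u b = sum (λ k → u k * b ^ toℕ k)

  -- The polynomial in xᵢ obtained from f by fixing the other coordinates to a,
  -- listed in order: its k-th coefficient collects all monomials of f in which
  -- xᵢ has exponent k.
  specialise : ∀ {m} → Poly (suc m) → Fin (suc m) → Vec Carrier m → UnivariatePoly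
  specialise {m} f i a k =
    sumExponents m (λ e → f (insertAt e i k) * monomial e a)

  -- With no variables the condition is vacuous.
  IsLPP : ∀ {n} → Poly n → Set (c ⊔ ℓ)
  IsLPP {zero}  f = ⊤
  IsLPP {suc m} f = ∀ (i : Fin (suc m)) (a : Vec Carrier m) →
    Bijective _≈_ _≈_ (evalUnivariate (specialise f i a))

{-# OPTIONS --safe #-}

-- Interpolation turns the problem into one about Latin hypercubes
-- f : F_qⁿ → F_q.  A variable never occurs with exponent q − 1, because that
-- part of the polynomial comes from the sums of f along lines, which vanish,
-- and the coefficient of (x₁⋯xₙ)^(q−2) is ± Σₐ f(a) a₁⋯aₙ; it remains to make
-- this nonzero.  Let N_f(s) be the sum of a₁⋯aₙ over the a with f(a) = s.  If
-- N_f is not constant, say N_f(s) ≠ N_f(t), then f or f with the values s and t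
-- exchanged has a nonzero coefficient.  A non-constant N_f is kept through the
-- recursion f'(x, a) = π(x) − ρ(f(a)), where π is a suitable transposition and
-- ρ is the identity or the exchange of s and t: N_f'(y) = Σₐ π(y + ρ(f(a))) a₁⋯aₙ,
-- and the same exchange argument applies to the difference of two such values.
module Submission where

open import Algebra.Bundles using (CommutativeMonoid; CommutativeRing)
import Algebra.Properties.CommutativeMonoid.Sum as MonoidSum
import Algebra.Properties.Ring as RingProperties
import Algebra.Properties.Semiring.Exp as Exp
import Algebra.Properties.Semiring.Mult as Mult
import Algebra.Properties.Semiring.Sum as Sum
import Algebra.Solver.Ring.NaturalCoefficients.Default as SemiringSolver
open import Data.Bool.Base using (if_then_else_)
open import Data.Fin.Base using (Fin; zero; suc; toℕ; fromℕ<)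
open import Data.Fin.Permutation using (Permutation′; permutation; _⟨$⟩ʳ_)
open import Data.Fin.Properties using (any?; pigeonhole; toℕ<n; toℕ-fromℕ<; toℕ-injective; <⇒≢) renaming (_≟_ to _≟ᶠ_; suc-injective to sucᶠ-injective)
open import Data.Nat.Base using (ℕ; zero; suc; z≤n; s≤s; s≤s⁻¹; _≤_; _<_; _^_; _*_; _∸_)
import Data.Nat.Base as ℕ
open import Data.Nat.Divisibility using (_∣_; divides; ∣1⇒≡1)
open import Data.Nat.Primality using (Prime; euclidsLemma; prime⇒irreducible; prime[2])
open import Data.Nat.Properties using (≤∧≢⇒<; +-mono-≤; m+[n∸m]≡n; ≤-trans; ∸-monoʳ-<; m+n∸n≡m; n∸n≡0)
open import Data.Product.Base using (_×_; _,_; proj₁; proj₂; ∃-syntax)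
open import Data.Sum.Base using (_⊎_; inj₁; inj₂)
open import Data.Unit.Polymorphic.Base using (⊤; tt)
open import Data.Vec.Base using (Vec; []; _∷_; map; insertAt; removeAt; lookup; replicate)
open import Data.Vec.Properties using (map-insertAt; insertAt-removeAt)
open import Function.Base using (_∘_; id)
open import Function.Bundles using (Inverse)
open import Function.Definitions using (Bijective; Congruent)
open import Level using (_⊔_)
open import Relation.Binary.PropositionalEquality as ≡ using (_≡_; _≢_)
open import Relation.Nullary using (¬_; Dec; yes; no; does; contradiction)
open import Relation.Nullary.Decidable using (map′; dec-true; dec-false; ¬?; decidable-stable; _⊎-dec_)
open import Defs

-- Sums with at most one nontrivial term, for addition and for multiplication.

module SingleTerm {c ℓ} (M : CommutativeMonoid c ℓ) where
  open CommutativeMonoid M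
  open MonoidSum M

  sum-ε : ∀ {n} (f : Fin n → Carrier) → (∀ k → f k ≈ ε) → sum f ≈ ε
  sum-ε {n} f f≈ε = trans (sum-cong-≋ f≈ε) (sum-replicate-zero n)

  sum-single : ∀ {n} (f : Fin n → Carrier) i → (∀ k → k ≢ i → f k ≈ ε) → sum f ≈ f i
  sum-single f zero    off = trans (∙-congˡ (sum-ε _ (λ k → off (suc k) (λ ())))) (identityʳ _)
  sum-single f (suc i) off =
    trans (∙-cong (off zero (λ ())) (sum-single (f ∘ suc) i (λ k k≢i → off (suc k) (k≢i ∘ sucᶠ-injective))))
          (identityˡ _)

module FiniteField {c ℓ} (F : CommutativeRing c ℓ) (q : ℕ) (3<q : 3 < q) (isFF : IsFiniteField F q) where

  open CommutativeRing F renaming (_*_ to _·_) hiding (zero)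
  open IsFiniteField isFF
  open Exp semiring using (^-congˡ; ^-congʳ; ^-homo-*) renaming (_^_ to _↑_)
  open Mult semiring using (×-assocˡ; ×-congˡ) renaming (_×_ to _×′_)
  open Sum semiring
  open SingleTerm +-commutativeMonoid
  open RingProperties ring
  open ReducedPolynomials F q
  open import Relation.Binary.Reasoning.Setoid setoid
  open SemiringSolver commutativeSemiring using (solve; _:+_; _:*_; _:=_)

  private
    module Π where
      open MonoidSum *-commutativeMonoid public
      open SingleTerm *-commutativeMonoid public

  -- Enumeration of the field and elementary arithmetic.

  elem : Fin q → Carrier
  elem = Inverse.to enumeration

  index : Carrier → Fin q
  index = Inverse.from enumeration

  elem-index : ∀ x → elem (index x) ≈ x
  elem-index x = Inverse.inverseˡ enumeration ≡.refl

  index-elem : ∀ k → index (elem k) ≡ k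
  index-elem k = Inverse.inverseʳ enumeration refl

  index-cong : ∀ {x y} → x ≈ y → index x ≡ index y
  index-cong = Inverse.from-cong enumeration

  index-injective : ∀ {x y} → index x ≡ index y → x ≈ y
  index-injective {x} {y} eq =
    trans (sym (elem-index x)) (trans (reflexive (≡.cong elem eq)) (elem-index y))

  elem-injective : ∀ {k l} → elem k ≈ elem l → k ≡ l
  elem-injective {k} {l} eq =
    ≡.trans (≡.sym (index-elem k)) (≡.trans (index-cong eq) (index-elem l))

  elem-bijective : Bijective _≡_ _≈_ elem
  elem-bijective = elem-injective , λ y → index y , λ { ≡.refl → elem-index y }

  infix 4 _≈?_
  opaque
    _≈?_ : ∀ x y → Dec (x ≈ y)
    x ≈? y = map′ index-injective index-cong (index x ≟ᶠ index y)

  *-cancelˡ-nonZero : ∀ {x y z} → x ≉ 0# → x · y ≈ x · z → y ≈ z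
  *-cancelˡ-nonZero {x} {y} {z} x≉0 xy≈xz with x⁻¹ , x⁻¹x≈1 , _ ← invertible x x≉0 = begin
    y               ≈⟨ *-identityˡ y ⟨
    1# · y          ≈⟨ *-congʳ x⁻¹x≈1 ⟨
    x⁻¹ · x · y     ≈⟨ *-assoc _ _ _ ⟩
    x⁻¹ · (x · y)   ≈⟨ *-congˡ xy≈xz ⟩
    x⁻¹ · (x · z)   ≈⟨ *-assoc _ _ _ ⟨
    x⁻¹ · x · z     ≈⟨ *-congʳ x⁻¹x≈1 ⟩
    1# · z          ≈⟨ *-identityˡ z ⟩
    z               ∎

  *-nonZero : ∀ {x y} → x ≉ 0# → y ≉ 0# → x · y ≉ 0#
  *-nonZero x≉0 y≉0 xy≈0 = y≉0 (*-cancelˡ-nonZero x≉0 (trans xy≈0 (sym (zeroʳ _))))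

  -≉0 : ∀ {x y} → x ≉ y → x - y ≉ 0#
  -≉0 x≉y = x≉y ∘ x∙y⁻¹≈ε⇒x≈y _ _

  x-y+y≈x : ∀ x y → x - y + y ≈ x
  x-y+y≈x x y = trans (+-assoc _ _ _) (trans (+-congˡ (-‿inverseˡ y)) (+-identityʳ x))

  x+y-y≈x : ∀ x y → x + y - y ≈ x
  x+y-y≈x x y = trans (+-assoc _ _ _) (trans (+-congˡ (-‿inverseʳ y)) (+-identityʳ x))

  x-[x-y]≈y : ∀ x y → x - (x - y) ≈ y
  x-[x-y]≈y x y = begin
    x + - (x - y)   ≈⟨ +-congˡ (⁻¹-anti-homo‿- x y) ⟩
    x + (y - x)     ≈⟨ +-comm _ _ ⟩
    y - x + x       ≈⟨ x-y+y≈x y x ⟩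
    y               ∎

  -- Were every element equal to one of the three, recording which one would inject a set of `q`
  -- elements into one of 3, against `3 < q`. The three may coincide, so the lemma also serves to
  -- avoid fewer elements.
  avoid-three : ∀ x y z → ∃[ w ] (w ≉ x × w ≉ y × w ≉ z)
  avoid-three x y z with any? (λ k → ¬? ((elem k ≈? x) ⊎-dec ((elem k ≈? y) ⊎-dec (elem k ≈? z))))
  ... | yes (k , k∉) = elem k , k∉ ∘ inj₁ , k∉ ∘ inj₂ ∘ inj₁ , k∉ ∘ inj₂ ∘ inj₂
  ... | no ¬∃ = contradiction (colour-injective _ _ same) (<⇒≢ i<j)
    where
    covered : ∀ k → (elem k ≈ x) ⊎ ((elem k ≈ y) ⊎ (elem k ≈ z))
    covered k = decidable-stable ((elem k ≈? x) ⊎-dec ((elem k ≈? y) ⊎-dec (elem k ≈? z))) (λ k∉ → ¬∃ (k , k∉))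
    which : ∀ {k} → (elem k ≈ x) ⊎ ((elem k ≈ y) ⊎ (elem k ≈ z)) → Fin 3
    which (inj₁ _)        = zero
    which (inj₂ (inj₁ _)) = suc zero
    which (inj₂ (inj₂ _)) = suc (suc zero)
    colour : Fin q → Fin 3
    colour k = which (covered k)
    colour-injective : ∀ k l → colour k ≡ colour l → k ≡ l
    colour-injective k l eq with covered k | covered l
    ... | inj₁ p        | inj₁ r        = elem-injective (trans p (sym r))
    ... | inj₂ (inj₁ p) | inj₂ (inj₁ r) = elem-injective (trans p (sym r))
    ... | inj₂ (inj₂ p) | inj₂ (inj₂ r) = elem-injective (trans p (sym r))
    colour-injective k l () | inj₁ _ | inj₂ (inj₁ _)
    colour-injective k l () | inj₁ _ | inj₂ (inj₂ _)
    colour-injective k l () | inj₂ (inj₁ _) | inj₁ _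
    colour-injective k l () | inj₂ (inj₂ _) | inj₁ _
    colour-injective k l () | inj₂ (inj₁ _) | inj₂ (inj₂ _)
    colour-injective k l () | inj₂ (inj₂ _) | inj₂ (inj₁ _)
    collision = pigeonhole 3<q colour
    i<j = proj₁ (proj₂ (proj₂ collision))
    same = proj₂ (proj₂ (proj₂ collision))

  -- Permutations of the field

  Permutes : (Carrier → Carrier) → Set (c ⊔ ℓ)
  Permutes ρ = Congruent _≈_ _≈_ ρ × Bijective _≈_ _≈_ ρ

  permutes-with-inverse : ∀ ρ σ → Congruent _≈_ _≈_ ρ → Congruent _≈_ _≈_ σ →
    (∀ x → ρ (σ x) ≈ x) → (∀ x → σ (ρ x) ≈ x) → Permutes ρ
  permutes-with-inverse ρ σ ρ-cong σ-cong ρσ σρ =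
    ρ-cong ,
    (λ {x} {y} eq → trans (sym (σρ x)) (trans (σ-cong eq) (σρ y))) ,
    (λ y → σ y , λ eq → trans (ρ-cong eq) (ρσ y))

  +-permutes : ∀ c → Permutes (_+ c)
  +-permutes c = permutes-with-inverse _ (_- c) +-congʳ +-congʳ (λ x → x-y+y≈x x c) (λ x → x+y-y≈x x c)

  minus-permutes : ∀ c → Permutes (λ x → c - x)
  minus-permutes c = permutes-with-inverse _ (λ x → c - x) minus-cong minus-cong (x-[x-y]≈y c) (x-[x-y]≈y c)
    where
    minus-cong : Congruent _≈_ _≈_ (λ x → c - x)
    minus-cong eq = +-congˡ (-‿cong eq)

  *-permutes : ∀ {c} → c ≉ 0# → Permutes (c ·_)
  *-permutes {c} c≉0 = *-congˡ , *-cancelˡ-nonZero c≉0 , onto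
    where
    c⁻¹ = proj₁ (invertible c c≉0)
    onto : ∀ y → ∃[ x ] (∀ {z} → z ≈ x → c · z ≈ y)
    onto y = c⁻¹ · y , λ {z} z≈ → begin
      c · z           ≈⟨ *-congˡ z≈ ⟩
      c · (c⁻¹ · y)   ≈⟨ *-assoc _ _ _ ⟨
      c · c⁻¹ · y     ≈⟨ *-congʳ (proj₂ (proj₂ (invertible c c≉0))) ⟩
      1# · y          ≈⟨ *-identityˡ y ⟩
      y               ∎

  permutes-∘ : ∀ {g : Fin q → Carrier} {ρ} → Bijective _≡_ _≈_ g → Permutes ρ → Bijective _≡_ _≈_ (ρ ∘ g)
  permutes-∘ (g-inj , g-surj) (ρ-cong , ρ-inj , ρ-surj) =
    (λ eq → g-inj (ρ-inj eq)) ,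
    λ y → proj₁ (g-surj (proj₁ (ρ-surj y))) , λ { ≡.refl → proj₂ (ρ-surj y) (proj₂ (g-surj _) ≡.refl) }

  -- A bijective listing is `elem` after a permutation of the indices, which makes invariance under
  -- reindexing available for sums, and in `fermat` for products.
  listing⇒permutation : ∀ {g : Fin q → Carrier} → Bijective _≡_ _≈_ g → Permutation′ q
  listing⇒permutation {g} (g-inj , g-surj) = permutation (index ∘ g) (λ l → proj₁ (g-surj (elem l)))
    (λ l → ≡.trans (index-cong (proj₂ (g-surj (elem l)) ≡.refl)) (index-elem l))
    (λ k → g-inj (trans (proj₂ (g-surj _) ≡.refl) (elem-index (g k))))

  sum-listing : ∀ {g : Fin q → Carrier} → Bijective _≡_ _≈_ g → sum g ≈ sum elem
  sum-listing {g} g-bij = begin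
    sum g                                              ≈⟨ sum-cong-≋ (λ k → elem-index (g k)) ⟨
    sum (λ k → elem (listing⇒permutation g-bij ⟨$⟩ʳ k)) ≈⟨ sum-permute elem (listing⇒permutation g-bij) ⟨
    sum elem                                           ∎

  -- Sums over the whole field and the characteristic.

  -- Translation by `x` permutes the field, so adding `x` to each of the `q` terms leaves the sum of
  -- all elements unchanged.
  q×x≈0 : ∀ x → q ×′ x ≈ 0#
  q×x≈0 x = +-identityʳ-unique (sum elem) (q ×′ x) (begin
    sum elem + q ×′ x               ≈⟨ +-congˡ (sum-replicate q) ⟨
    sum elem + sum (λ (_ : Fin q) → x) ≈⟨ ∑-distrib-+ elem (λ _ → x) ⟨
    sum (λ k → elem k + x)          ≈⟨ sum-listing (permutes-∘ elem-bijective (+-permutes x)) ⟩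
    sum elem                        ∎)

  -- Multiplication by some `w` other than 0 and 1 permutes the field, so the sum S of all elements
  -- satisfies wS = S, and w - 1 can be cancelled.
  sum-elem≈0 : sum elem ≈ 0#
  sum-elem≈0 with w , w≉0 , w≉1 , _ ← avoid-three 0# 1# 1# =
    *-cancelˡ-nonZero (-≉0 w≉1) (begin
      (w - 1#) · sum elem               ≈⟨ [y-z]x≈yx-zx _ _ _ ⟩
      w · sum elem - 1# · sum elem      ≈⟨ +-cong w·sum (-‿cong (*-identityˡ _)) ⟩
      sum elem - sum elem               ≈⟨ -‿inverseʳ _ ⟩
      0#                                ≈⟨ zeroʳ _ ⟨
      (w - 1#) · 0#                     ∎)
    where
    w·sum : w · sum elem ≈ sum elem
    w·sum = trans (*-distribˡ-sum w elem) (sum-listing (permutes-∘ elem-bijective (*-permutes w≉0)))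

  sum-listing≈0 : ∀ {g : Fin q → Carrier} → Bijective _≡_ _≈_ g → sum g ≈ 0#
  sum-listing≈0 g-bij = trans (sum-listing g-bij) sum-elem≈0

  -- If 2 = 0 and q = 2k + 1, then q · 1 = 1, whereas `q×x≈0` makes it 0.
  odd⇒2≉0 : ¬ 2 ∣ q → 1# + 1# ≉ 0#
  odd⇒2≉0 2∤q 2≈0 with parity q
    where
    parity : ∀ n → ∃[ k ] (n ≡ k * 2 ⊎ n ≡ suc (k * 2))
    parity zero = 0 , inj₁ ≡.refl
    parity (suc n) with parity n
    ... | k , inj₁ eq = k , inj₂ (≡.cong suc eq)
    ... | k , inj₂ eq = suc k , inj₁ (≡.cong suc eq)
  ... | k , inj₁ eq = 2∤q (divides k eq)
  ... | k , inj₂ eq = 1≉0 (begin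
    1#                     ≈⟨ +-identityʳ 1# ⟨
    1# + 0#                ≈⟨ +-congˡ (zeros k) ⟨
    1# + k ×′ (2 ×′ 1#)    ≈⟨ +-congˡ (×-assocˡ 1# k 2) ⟩
    suc (k * 2) ×′ 1#      ≈⟨ ×-congˡ eq ⟨
    q ×′ 1#                ≈⟨ q×x≈0 1# ⟩
    0#                     ∎)
    where
    zeros : ∀ k → k ×′ (2 ×′ 1#) ≈ 0#
    zeros zero    = refl
    zeros (suc k) = trans (+-cong (trans (+-congˡ (+-identityʳ 1#)) 2≈0) (zeros k)) (+-identityʳ 0#)

  -- Lagrange interpolation

  -- For `x` nonzero, the `q` factors are split in two: `scale` puts `x` at the nonzero elements,
  -- with product 1 because multiplication by `x` permutes them, and `spare` puts the remaining `x`
  -- at 0.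
  fermat : ∀ x → x ↑ q ≈ x
  fermat x with x ≈? 0#
  ... | yes x≈0 = trans (power 3<q) (sym x≈0)
    where
    -- Restated for a variable `n`, so that matching the bound exposes a successor.
    power : ∀ {n} → 3 < n → x ↑ n ≈ 0#
    power (s≤s _) = trans (*-congʳ x≈0) (zeroˡ _)
  ... | no x≉0 = begin
    x ↑ q                                        ≈⟨ Π.sum-replicate q ⟨
    Π.sum (λ (_ : Fin q) → x)                    ≈⟨ Π.sum-cong-≋ (factor ∘ elem) ⟨
    Π.sum (λ k → scale (elem k) · spare (elem k)) ≈⟨ Π.∑-distrib-+ (scale ∘ elem) (spare ∘ elem) ⟩
    Π.sum (scale ∘ elem) · Π.sum (spare ∘ elem)  ≈⟨ *-cong scale-product spare-product ⟩
    1# · x                                       ≈⟨ *-identityˡ x ⟩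
    x                                            ∎
    where
    -- Multiplication by x permutes the nonzero elements; unit replaces the
    -- element 0 by 1, so that the product can run over the whole field.
    unit scale spare : Carrier → Carrier
    unit  y = if does (y ≈? 0#) then 1# else y
    scale y = if does (y ≈? 0#) then 1# else x
    spare y = if does (y ≈? 0#) then x else 1#

    factor : ∀ y → scale y · spare y ≈ x
    factor y with y ≈? 0#
    ... | yes _ = *-identityˡ x
    ... | no  _ = *-identityʳ x

    unit-nonZero : ∀ y → unit y ≉ 0#
    unit-nonZero y with y ≈? 0#
    ... | yes _   = 1≉0
    ... | no  y≉0 = y≉0

    unit-cong : ∀ {y z} → y ≈ z → unit y ≈ unit z
    unit-cong {y} {z} y≈z with y ≈? 0# | z ≈? 0#
    ... | yes _   | yes _   = refl
    ... | yes y≈0 | no z≉0  = contradiction (trans (sym y≈z) y≈0) z≉0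
    ... | no y≉0  | yes z≈0 = contradiction (trans y≈z z≈0) y≉0
    ... | no _    | no _    = y≈z

    scale-unit : ∀ y → unit (x · y) ≈ scale y · unit y
    scale-unit y with y ≈? 0# | x · y ≈? 0#
    ... | yes _   | yes _    = sym (*-identityˡ 1#)
    ... | yes y≈0 | no xy≉0  = contradiction (trans (*-congˡ y≈0) (zeroʳ x)) xy≉0
    ... | no y≉0  | yes xy≈0 = contradiction xy≈0 (*-nonZero x≉0 y≉0)
    ... | no _    | no _     = refl

    units-nonZero : ∀ {n} (g : Fin n → Carrier) → Π.sum (unit ∘ g) ≉ 0#
    units-nonZero {zero}  g = 1≉0
    units-nonZero {suc n} g = *-nonZero (unit-nonZero (g zero)) (units-nonZero (g ∘ suc))

    listing : Bijective _≡_ _≈_ (λ k → x · elem k)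
    listing = permutes-∘ elem-bijective (*-permutes x≉0)

    scale-product : Π.sum (scale ∘ elem) ≈ 1#
    scale-product = *-cancelˡ-nonZero (units-nonZero elem) (begin
      Π.sum (unit ∘ elem) · Π.sum (scale ∘ elem)      ≈⟨ *-comm _ _ ⟩
      Π.sum (scale ∘ elem) · Π.sum (unit ∘ elem)      ≈⟨ Π.∑-distrib-+ (scale ∘ elem) (unit ∘ elem) ⟨
      Π.sum (λ k → scale (elem k) · unit (elem k))    ≈⟨ Π.sum-cong-≋ (scale-unit ∘ elem) ⟨
      Π.sum (λ k → unit (x · elem k))                 ≈⟨ Π.sum-cong-≋ (λ k → unit-cong (elem-index (x · elem k))) ⟨
      Π.sum (λ k → unit (elem (listing⇒permutation listing ⟨$⟩ʳ k)))
                                                      ≈⟨ Π.sum-permute (unit ∘ elem) (listing⇒permutation listing) ⟨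
      Π.sum (unit ∘ elem)                             ≈⟨ *-identityʳ _ ⟨
      Π.sum (unit ∘ elem) · 1#                        ∎)

    spare-product : Π.sum (spare ∘ elem) ≈ x
    spare-product = trans (Π.sum-single (spare ∘ elem) (index 0#) off)
      (reflexive (≡.cong (if_then x else 1#) (dec-true (elem (index 0#) ≈? 0#) (elem-index 0#))))
      where
      off : ∀ k → k ≢ index 0# → spare (elem k) ≈ 1#
      off k k≢ = reflexive (≡.cong (if_then x else 1#) (dec-false (elem k ≈? 0#)
        (λ k≈0 → k≢ (elem-injective (trans k≈0 (sym (elem-index 0#)))))))

  geometric : ℕ → Carrier → Carrier → Carrier
  geometric n a b = sum {n} (λ k → b ↑ toℕ k · a ↑ (n ∸ suc (toℕ k)))

  -- (b − a) Σₖ bᵏ aⁿ⁻¹⁻ᵏ = bⁿ − aⁿ, stated without subtraction.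
  geometric-telescopes : ∀ n a b → b · geometric n a b + a ↑ n ≈ a · geometric n a b + b ↑ n
  geometric-telescopes zero a b = +-congʳ (trans (zeroʳ b) (sym (zeroʳ a)))
  geometric-telescopes (suc n) a b = begin
    b · geometric (suc n) a b + a · a ↑ n         ≈⟨ +-congʳ (*-congˡ unfold) ⟩
    b · (a ↑ n + b · G) + a · a ↑ n               ≈⟨ solve 4 (λ b A G a → b :* (A :+ b :* G) :+ a :* A := b :* (b :* G :+ A) :+ a :* A) refl b (a ↑ n) G a ⟩
    b · (b · G + a ↑ n) + a · a ↑ n               ≈⟨ +-congʳ (*-congˡ (geometric-telescopes n a b)) ⟩
    b · (a · G + b ↑ n) + a · a ↑ n               ≈⟨ solve 5 (λ b A G a B → b :* (a :* G :+ B) :+ a :* A := a :* (A :+ b :* G) :+ b :* B) refl b (a ↑ n) G a (b ↑ n) ⟩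
    a · (a ↑ n + b · G) + b · b ↑ n               ≈⟨ +-congʳ (*-congˡ unfold) ⟨
    a · geometric (suc n) a b + b · b ↑ n         ∎
    where
    G = geometric n a b
    unfold : geometric (suc n) a b ≈ a ↑ n + b · G
    unfold = +-cong (*-identityˡ _) (begin
      sum {n} (λ k → b · b ↑ toℕ k · a ↑ (n ∸ suc (toℕ k)))     ≈⟨ sum-cong-≋ {n} (λ k → *-assoc _ _ _) ⟩
      sum {n} (λ k → b · (b ↑ toℕ k · a ↑ (n ∸ suc (toℕ k))))   ≈⟨ *-distribˡ-sum {n} b _ ⟨
      b · G                                                     ∎)

  -- By `fermat` the telescoping identity at exponent `q` reads (b - a) G = b - a, and b - a can be
  -- cancelled.
  geometric-≉ : ∀ {a b} → a ≉ b → geometric q a b ≈ 1#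
  geometric-≉ {a} {b} a≉b = *-cancelˡ-nonZero (-≉0 (a≉b ∘ sym)) (begin
    (b - a) · G               ≈⟨ [y-z]x≈yx-zx _ _ _ ⟩
    b · G - a · G             ≈⟨ +-congʳ (x+y-y≈x (b · G) a) ⟨
    b · G + a - a - a · G     ≈⟨ +-congʳ (+-congʳ step) ⟩
    a · G + b - a - a · G     ≈⟨ solve 4 (λ x b a' x' → x :+ b :+ a' :+ x' := x :+ x' :+ (b :+ a')) refl (a · G) b (- a) (- (a · G)) ⟩
    a · G - a · G + (b - a)   ≈⟨ +-congʳ (-‿inverseʳ _) ⟩
    0# + (b - a)              ≈⟨ +-identityˡ _ ⟩
    b - a                     ≈⟨ *-identityʳ _ ⟨
    (b - a) · 1#              ∎)
    where
    G = geometric q a b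
    step : b · G + a ≈ a · G + b
    step = trans (+-congˡ (sym (fermat a))) (trans (geometric-telescopes q a b) (+-congˡ (fermat b)))

  -- All `q` terms equal a^(q-1), and `q` times anything is 0.
  geometric-≈ : ∀ {a b} → a ≈ b → geometric q a b ≈ 0#
  geometric-≈ {a} {b} a≈b = begin
    geometric q a b                        ≈⟨ sum-cong-≋ {q} term ⟩
    sum (λ (_ : Fin q) → a ↑ (q ∸ 1))      ≈⟨ sum-replicate q ⟩
    q ×′ (a ↑ (q ∸ 1))                     ≈⟨ q×x≈0 _ ⟩
    0#                                     ∎
    where
    k+[n∸1+k]≡n∸1 : ∀ {k n} → k < n → k ℕ.+ (n ∸ suc k) ≡ n ∸ 1
    k+[n∸1+k]≡n∸1 (s≤s k≤n) = m+[n∸m]≡n k≤n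
    term : ∀ (k : Fin q) → b ↑ toℕ k · a ↑ (q ∸ suc (toℕ k)) ≈ a ↑ (q ∸ 1)
    term k = begin
      b ↑ toℕ k · a ↑ (q ∸ suc (toℕ k))   ≈⟨ *-congʳ (^-congˡ (toℕ k) a≈b) ⟨
      a ↑ toℕ k · a ↑ (q ∸ suc (toℕ k))   ≈⟨ ^-homo-* a (toℕ k) _ ⟨
      a ↑ (toℕ k ℕ.+ (q ∸ suc (toℕ k)))   ≈⟨ ^-congʳ a (k+[n∸1+k]≡n∸1 (toℕ<n k)) ⟩
      a ↑ (q ∸ 1)                         ∎

  -- The coefficients of the constant polynomial 1.
  one : ℕ → Carrier
  one zero    = 1#
  one (suc _) = 0#

  -- The coefficients of 1 − (x − a)^(q−1) = 1 − Σₖ a^(q−1−k) xᵏ, the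
  -- indicator polynomial of a = elem l.
  lagrange : Fin q → Fin q → Carrier
  lagrange k l = one (toℕ k) - elem l ↑ (q ∸ suc (toℕ k))

  -- The powers subtracted in `lagrange` are the terms of `geometric`, so only the constant
  -- polynomial 1 remains. The two values of `geometric` then give those of the indicator.
  lagrange+geometric : ∀ l b → sum (λ k → lagrange k l · b ↑ toℕ k) + geometric q (elem l) b ≈ 1#
  lagrange+geometric l b = begin
    sum (λ k → lagrange k l · b ↑ toℕ k) + geometric q (elem l) b
      ≈⟨ ∑-distrib-+ (λ k → lagrange k l · b ↑ toℕ k) _ ⟨
    sum (λ k → lagrange k l · b ↑ toℕ k + b ↑ toℕ k · elem l ↑ (q ∸ suc (toℕ k)))
      ≈⟨ sum-cong-≋ {q} (λ k → term (one (toℕ k)) (b ↑ toℕ k) (elem l ↑ (q ∸ suc (toℕ k)))) ⟩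
    sum {q} (λ k → one (toℕ k) · b ↑ toℕ k)
      ≈⟨ constant 3<q ⟩
    1# ∎
    where
    term : ∀ c B A → (c - A) · B + B · A ≈ c · B
    term c B A = begin
      (c - A) · B + B · A   ≈⟨ +-congˡ (*-comm B A) ⟩
      (c - A) · B + A · B   ≈⟨ distribʳ B _ _ ⟨
      (c - A + A) · B       ≈⟨ *-congʳ (x-y+y≈x c A) ⟩
      c · B                 ∎
    constant : ∀ {n} → 3 < n → sum {n} (λ k → one (toℕ k) · b ↑ toℕ k) ≈ 1#
    constant (s≤s {n = n} _) = trans (+-cong (*-identityˡ 1#) (sum-ε {n} _ (λ k → zeroˡ _))) (+-identityʳ 1#)

  lagrange-≈ : ∀ l b → elem l ≈ b → sum (λ k → lagrange k l · b ↑ toℕ k) ≈ 1#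
  lagrange-≈ l b l≈b = begin
    sum (λ k → lagrange k l · b ↑ toℕ k)        ≈⟨ +-identityʳ _ ⟨
    sum (λ k → lagrange k l · b ↑ toℕ k) + 0#   ≈⟨ +-congˡ (geometric-≈ l≈b) ⟨
    _                                           ≈⟨ lagrange+geometric l b ⟩
    1#                                          ∎

  lagrange-≉ : ∀ l b → elem l ≉ b → sum (λ k → lagrange k l · b ↑ toℕ k) ≈ 0#
  lagrange-≉ l b l≉b = +-identityˡ-unique _ 1#
    (trans (+-congˡ (sym (geometric-≉ l≉b))) (lagrange+geometric l b))

  -- Interpolation in several variables.

  -- A function on the points of the affine space, which are given by their indices under `elem`; it
  -- then respects equality of points automatically.
  Table : ℕ → Set c
  Table n = Vec (Fin q) n → Carrier

  -- The coefficients of the sum over all points of f(x) times the product of the one-variable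
  -- indicators of its coordinates, expanded one variable at a time.
  interpolate : ∀ {n} → Table n → Poly n
  interpolate f []      = f []
  interpolate f (k ∷ e) = sum (λ l → lagrange k l · interpolate (λ x → f (l ∷ x)) e)

  interpolate-cong : ∀ {n} {f g : Table n} → (∀ x → f x ≈ g x) → ∀ e → interpolate f e ≈ interpolate g e
  interpolate-cong f≈g []      = f≈g []
  interpolate-cong f≈g (k ∷ e) = sum-cong-≋ (λ l → *-congˡ (interpolate-cong (λ x → f≈g (l ∷ x)) e))

  interpolate-zero : ∀ {n} (f : Table n) → (∀ x → f x ≈ 0#) → ∀ e → interpolate f e ≈ 0#
  interpolate-zero f f≈0 []      = f≈0 []
  interpolate-zero f f≈0 (k ∷ e) =
    sum-ε _ (λ l → trans (*-congˡ (interpolate-zero _ (λ x → f≈0 (l ∷ x)) e)) (zeroʳ _))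

  -- This combined form gives arbitrary finite combinations by induction, and it fits the identity
  -- of `swap-difference` directly.
  interpolate-linear : ∀ {n} a (f g : Table n) e →
    interpolate (λ x → a · f x + g x) e ≈ a · interpolate f e + interpolate g e
  interpolate-linear a f g []      = refl
  interpolate-linear a f g (k ∷ e) = begin
    sum (λ l → L l · interpolate (λ x → a · f (l ∷ x) + g (l ∷ x)) e)
      ≈⟨ sum-cong-≋ {q} (λ l → *-congˡ (interpolate-linear a _ _ e)) ⟩
    sum (λ l → L l · (a · A l + B l))
      ≈⟨ sum-cong-≋ (λ l → solve 4 (λ L a A B → L :* (a :* A :+ B) := a :* (L :* A) :+ L :* B) refl (L l) a (A l) (B l)) ⟩
    sum (λ l → a · (L l · A l) + L l · B l)
      ≈⟨ ∑-distrib-+ (λ l → a · (L l · A l)) _ ⟩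
    sum (λ l → a · (L l · A l)) + sum (λ l → L l · B l)
      ≈⟨ +-congʳ (*-distribˡ-sum {q} a _) ⟨
    a · sum (λ l → L l · A l) + sum (λ l → L l · B l) ∎
    where
    L A B : Fin q → Carrier
    L l = lagrange k l
    A l = interpolate (λ x → f (l ∷ x)) e
    B l = interpolate (λ x → g (l ∷ x)) e

  interpolate-sum : ∀ {n N} (w : Fin N → Carrier) (f : Fin N → Table n) e →
    interpolate (λ x → sum (λ l → w l · f l x)) e ≈ sum (λ l → w l · interpolate (f l) e)
  interpolate-sum {N = zero}  w f e = interpolate-zero _ (λ _ → refl) e
  interpolate-sum {N = suc N} w f e =
    trans (interpolate-linear (w zero) (f zero) _ e) (+-congˡ (interpolate-sum (w ∘ suc) (f ∘ suc) e))

  sumExponents-cong : ∀ n {f g : Poly n} → (∀ e → f e ≈ g e) → sumExponents n f ≈ sumExponents n g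
  sumExponents-cong zero    f≈g = f≈g []
  sumExponents-cong (suc n) f≈g = sum-cong-≋ (λ k → sumExponents-cong n (λ e → f≈g (k ∷ e)))

  sumExponents-sum : ∀ n {N} (w : Fin N → Carrier) (f : Fin N → Poly n) →
    sumExponents n (λ e → sum (λ l → w l · f l e)) ≈ sum (λ l → w l · sumExponents n (f l))
  sumExponents-sum zero    w f = refl
  sumExponents-sum (suc n) w f = begin
    sum (λ k → sumExponents n (λ e → sum (λ l → w l · f l (k ∷ e))))
      ≈⟨ sum-cong-≋ (λ k → sumExponents-sum n w (λ l e → f l (k ∷ e))) ⟩
    sum (λ k → sum (λ l → w l · sumExponents n (λ e → f l (k ∷ e))))
      ≈⟨ ∑-comm (λ k l → w l · sumExponents n (λ e → f l (k ∷ e))) ⟩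
    sum (λ l → sum (λ k → w l · sumExponents n (λ e → f l (k ∷ e))))
      ≈⟨ sum-cong-≋ (λ l → *-distribˡ-sum (w l) (λ k → sumExponents n (λ e → f l (k ∷ e)))) ⟨
    sum (λ l → w l · sumExponents (suc n) (f l)) ∎

  -- By induction on the number of variables. With the sums exchanged, the sum over `k` evaluates
  -- the indicator of `elem l` at `b`, so only `l = index b` survives.
  interpolate-correct : ∀ {n} (f : Table n) (b : Vec Carrier n) →
    sumExponents n (λ e → interpolate f e · monomial e b) ≈ f (map index b)
  interpolate-correct f [] = *-identityʳ _
  interpolate-correct {suc n} f (b ∷ bs) = begin
    sum (λ k → sumExponents n (λ e → sum (λ l → lagrange k l · I l e) · (b ↑ toℕ k · monomial e bs)))
      ≈⟨ sum-cong-≋ (λ k → sumExponents-cong n (λ e → collect k e)) ⟩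
    sum (λ k → sumExponents n (λ e → sum (λ l → (lagrange k l · b ↑ toℕ k) · (I l e · monomial e bs))))
      ≈⟨ sum-cong-≋ (λ k → sumExponents-sum n (λ l → lagrange k l · b ↑ toℕ k) (λ l e → I l e · monomial e bs)) ⟩
    sum (λ k → sum (λ l → (lagrange k l · b ↑ toℕ k) · sumExponents n (λ e → I l e · monomial e bs)))
      ≈⟨ sum-cong-≋ {q} (λ k → sum-cong-≋ {q} (λ l → *-congˡ (interpolate-correct (λ x → f (l ∷ x)) bs))) ⟩
    sum (λ k → sum (λ l → (lagrange k l · b ↑ toℕ k) · V l))
      ≈⟨ ∑-comm (λ k l → (lagrange k l · b ↑ toℕ k) · V l) ⟩
    sum (λ l → sum (λ k → (lagrange k l · b ↑ toℕ k) · V l))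
      ≈⟨ sum-cong-≋ (λ l → *-distribʳ-sum (V l) (λ k → lagrange k l · b ↑ toℕ k)) ⟨
    sum (λ l → sum (λ k → lagrange k l · b ↑ toℕ k) · V l)
      ≈⟨ sum-single (λ l → sum (λ k → lagrange k l · b ↑ toℕ k) · V l) (index b) off ⟩
    sum (λ k → lagrange k (index b) · b ↑ toℕ k) · V (index b)
      ≈⟨ *-congʳ (lagrange-≈ (index b) b (elem-index b)) ⟩
    1# · V (index b)
      ≈⟨ *-identityˡ _ ⟩
    V (index b) ∎
    where
    I : Fin q → Poly n
    I l = interpolate (λ x → f (l ∷ x))
    V : Fin q → Carrier
    V l = f (l ∷ map index bs)
    collect : ∀ k e → sum (λ l → lagrange k l · I l e) · (b ↑ toℕ k · monomial e bs) ≈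
                      sum (λ l → (lagrange k l · b ↑ toℕ k) · (I l e · monomial e bs))
    collect k e = trans (*-distribʳ-sum (b ↑ toℕ k · monomial e bs) (λ l → lagrange k l · I l e))
      (sum-cong-≋ (λ l → solve 4 (λ L I B M → L :* I :* (B :* M) := (L :* B) :* (I :* M)) refl (lagrange k l) (I l e) (b ↑ toℕ k) (monomial e bs)))
    off : ∀ l → l ≢ index b → sum (λ k → lagrange k l · b ↑ toℕ k) · V l ≈ 0#
    off l l≢ = trans (*-congʳ (lagrange-≉ l b (λ l≈b → l≢ (elem-injective (trans l≈b (sym (elem-index b))))))) (zeroˡ _)

  -- Specialisation to one variable.

  sumExponents-insertAt : ∀ {n} (i : Fin (suc n)) (g : Poly (suc n)) →
    sumExponents (suc n) g ≈ sum (λ k → sumExponents n (λ e → g (insertAt e i k)))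
  sumExponents-insertAt zero g = refl
  sumExponents-insertAt {suc n} (suc i) g =
    trans (sum-cong-≋ (λ l → sumExponents-insertAt i (λ e → g (l ∷ e))))
          (∑-comm (λ l k → sumExponents n (λ e → g (l ∷ insertAt e i k))))

  monomial-insertAt : ∀ {n} (e : Exponents n) (a : Vec Carrier n) i k b →
    monomial (insertAt e i k) (insertAt a i b) ≈ b ↑ toℕ k · monomial e a
  monomial-insertAt e       a       zero    k b = refl
  monomial-insertAt (l ∷ e) (x ∷ a) (suc i) k b = trans (*-congˡ (monomial-insertAt e a i k b))
    (solve 3 (λ X B M → X :* (B :* M) := B :* (X :* M)) refl (x ↑ toℕ l) (b ↑ toℕ k) (monomial e a))

  -- Passes from the coefficients of a specialisation to values of `f`, so that the LPP condition
  -- can be read off the lines of a table.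
  evalUnivariate-specialise : ∀ {n} (f : Poly (suc n)) i a b →
    evalUnivariate (specialise f i a) b ≈ sumExponents (suc n) (λ e → f e · monomial e (insertAt a i b))
  evalUnivariate-specialise {n} f i a b = begin
    sum (λ k → sumExponents n (λ e → f (insertAt e i k) · monomial e a) · b ↑ toℕ k)
      ≈⟨ sum-cong-≋ (λ k → absorb n (b ↑ toℕ k) (λ e → f (insertAt e i k) · monomial e a)) ⟩
    sum (λ k → sumExponents n (λ e → f (insertAt e i k) · monomial e a · b ↑ toℕ k))
      ≈⟨ sum-cong-≋ (λ k → sumExponents-cong n (λ e → rearrange k e)) ⟩
    sum (λ k → sumExponents n (λ e → f (insertAt e i k) · monomial (insertAt e i k) (insertAt a i b)))
      ≈⟨ sumExponents-insertAt i (λ e → f e · monomial e (insertAt a i b)) ⟨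
    sumExponents (suc n) (λ e → f e · monomial e (insertAt a i b)) ∎
    where
    absorb : ∀ n c (g : Poly n) → sumExponents n g · c ≈ sumExponents n (λ e → g e · c)
    absorb zero    c g = refl
    absorb (suc n) c g = trans (*-distribʳ-sum c (λ k → sumExponents n (λ e → g (k ∷ e))))
                               (sum-cong-≋ (λ k → absorb n c (λ e → g (k ∷ e))))
    rearrange : ∀ k e → f (insertAt e i k) · monomial e a · b ↑ toℕ k ≈
                        f (insertAt e i k) · monomial (insertAt e i k) (insertAt a i b)
    rearrange k e = begin
      f (insertAt e i k) · monomial e a · b ↑ toℕ k     ≈⟨ *-assoc _ _ _ ⟩
      f (insertAt e i k) · (monomial e a · b ↑ toℕ k)   ≈⟨ *-congˡ (*-comm _ _) ⟩
      f (insertAt e i k) · (b ↑ toℕ k · monomial e a)   ≈⟨ *-congˡ (monomial-insertAt e a i k b) ⟨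
      f (insertAt e i k) · monomial (insertAt e i k) (insertAt a i b) ∎

  -- Latin hypercubes

  Latin : ∀ {n} → Table n → Set (c ⊔ ℓ)
  Latin {zero}  f = ⊤
  Latin {suc n} f = ∀ i (a : Vec (Fin q) n) → Bijective _≡_ _≈_ (λ k → f (insertAt a i k))

  Latin⇒IsLPP : ∀ {n} {f : Table n} → Latin f → IsLPP (interpolate f)
  Latin⇒IsLPP {zero}  _ = tt
  Latin⇒IsLPP {suc n} {f} latin i a = injective , surjective
    where
    line : Fin q → Carrier
    line k = f (insertAt (map index a) i k)
    value : ∀ b → evalUnivariate (specialise (interpolate f) i a) b ≈ line (index b)
    value b = trans (evalUnivariate-specialise (interpolate f) i a b)
      (trans (interpolate-correct f (insertAt a i b)) (reflexive (≡.cong f (map-insertAt index b a i))))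
    injective : ∀ {x y} → evalUnivariate (specialise (interpolate f) i a) x ≈ evalUnivariate (specialise (interpolate f) i a) y → x ≈ y
    injective {x} {y} eq = index-injective (proj₁ (latin i (map index a)) (trans (sym (value x)) (trans eq (value y))))
    surjective : ∀ y → ∃[ x ] (∀ {z} → z ≈ x → evalUnivariate (specialise (interpolate f) i a) z ≈ y)
    surjective y with k , line-k ← proj₂ (latin i (map index a)) y =
      elem k , λ {z} z≈ → trans (value z) (line-k (≡.trans (index-cong z≈) (index-elem k)))

  -- The coefficients at exponents q - 2 and q - 1, and the degree.

  top last : Fin q
  top  = fromℕ< {q ∸ 2} (∸-monoʳ-< (s≤s z≤n) (≤-trans (s≤s (s≤s z≤n)) 3<q))
  last = fromℕ< {q ∸ 1} (∸-monoʳ-< (s≤s z≤n) (≤-trans (s≤s z≤n) 3<q))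

  toℕ-top : toℕ top ≡ q ∸ 2
  toℕ-top = toℕ-fromℕ< _

  toℕ-last : toℕ last ≡ q ∸ 1
  toℕ-last = toℕ-fromℕ< _

  -- At exponent q - 2 the power of `elem l` is the first, and the constant 1 does not contribute
  -- because q - 2 > 0. This is the source of the factors aᵢ in the leading coefficient.
  lagrange-top : ∀ l → lagrange top l ≈ - elem l
  lagrange-top l = begin
    lagrange top l                                ≡⟨ ≡.cong (λ k → one k - elem l ↑ (q ∸ suc k)) toℕ-top ⟩
    one (q ∸ 2) - elem l ↑ (q ∸ suc (q ∸ 2))      ≈⟨ simplify 3<q ⟩
    - elem l                                      ∎
    where
    simplify : ∀ {n} → 3 < n → one (n ∸ 2) - elem l ↑ (n ∸ suc (n ∸ 2)) ≈ - elem l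
    simplify (s≤s (s≤s (s≤s {n = n} _))) = trans (+-identityˡ _)
      (-‿cong (trans (^-congʳ (elem l) (m+n∸n≡m 1 n)) (*-identityʳ _)))

  -- The power of `elem l` here is the zeroth, so the weight is the same for every `l`, including
  -- the index of 0.
  lagrange-last : ∀ l → lagrange last l ≈ - 1#
  lagrange-last l = begin
    lagrange last l                               ≡⟨ ≡.cong (λ k → one k - elem l ↑ (q ∸ suc k)) toℕ-last ⟩
    one (q ∸ 1) - elem l ↑ (q ∸ suc (q ∸ 1))      ≈⟨ simplify 3<q ⟩
    - 1#                                          ∎
    where
    simplify : ∀ {n} → 3 < n → one (n ∸ 1) - elem l ↑ (n ∸ suc (n ∸ 1)) ≈ - 1#
    simplify (s≤s (s≤s {n = n} _)) = trans (+-identityˡ _) (-‿cong (^-congʳ (elem l) (n∸n≡0 n)))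

  -- For the first variable all weights are -1, so by linearity the coefficient interpolates minus
  -- the sums along the lines. The other variables follow by induction.
  interpolate-last : ∀ {n} (f : Table (suc n)) i →
    (∀ a → sum (λ k → f (insertAt a i k)) ≈ 0#) →
    ∀ e → interpolate f (insertAt e i last) ≈ 0#
  interpolate-last f zero sums e = trans (sym (interpolate-sum (lagrange last) (λ l x → f (l ∷ x)) e))
    (interpolate-zero _ (λ x → begin
      sum (λ l → lagrange last l · f (l ∷ x))  ≈⟨ sum-cong-≋ (λ l → *-congʳ (lagrange-last l)) ⟩
      sum (λ l → - 1# · f (l ∷ x))             ≈⟨ *-distribˡ-sum (- 1#) (λ l → f (l ∷ x)) ⟨
      - 1# · sum (λ l → f (l ∷ x))             ≈⟨ *-congˡ (sums x) ⟩
      - 1# · 0#                                ≈⟨ zeroʳ _ ⟩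
      0#                                       ∎) e)
  interpolate-last f (suc i) sums (k ∷ e) = sum-ε _ (λ l →
    trans (*-congˡ (interpolate-last (λ x → f (l ∷ x)) i (λ a → sums (l ∷ a)) e)) (zeroʳ _))

  totalDegree-bound : ∀ {n} (e : Exponents n) d → (∀ i → toℕ (lookup e i) ≤ d) → totalDegree e ≤ n * d
  totalDegree-bound []      d bound = z≤n
  totalDegree-bound (k ∷ e) d bound = +-mono-≤ (bound zero) (totalDegree-bound e d (bound ∘ suc))

  totalDegree-replicate : ∀ n k → totalDegree (replicate n k) ≡ n * toℕ k
  totalDegree-replicate zero    k = ≡.refl
  totalDegree-replicate (suc n) k = ≡.cong (toℕ k ℕ.+_) (totalDegree-replicate n k)

  ≢last⇒≤ : ∀ (k : Fin q) → k ≢ last → toℕ k ≤ q ∸ 2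
  ≢last⇒≤ k k≢ = bound (toℕ<n k) (λ eq → k≢ (toℕ-injective (≡.trans eq (≡.sym toℕ-last))))
    where
    bound : ∀ {k n} → k < n → k ≢ n ∸ 1 → k ≤ n ∸ 2
    bound {k} {suc zero}    (s≤s k≤0) _  = k≤0
    bound {k} {suc (suc n)} (s≤s k≤n) k≢ = s≤s⁻¹ (≤∧≢⇒< k≤n k≢)

  -- Each line lists the whole field and sums to 0, so an exponent q - 1 anywhere in `e` would make
  -- the coefficient vanish; all exponents are thus at most q - 2.
  Latin⇒totalDegree : ∀ {n} {f : Table n} → Latin f → ∀ e → interpolate f e ≉ 0# → totalDegree e ≤ n * (q ∸ 2)
  Latin⇒totalDegree {zero}  latin [] _ = z≤n
  Latin⇒totalDegree {suc n} {f} latin e e≉0 = totalDegree-bound e (q ∸ 2) (λ i → ≢last⇒≤ (lookup e i) (λ eq → e≉0 (vanish i eq)))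
    where
    vanish : ∀ i → lookup e i ≡ last → interpolate f e ≈ 0#
    vanish i eq = trans (reflexive (≡.cong (interpolate f) (≡.trans (≡.sym (insertAt-removeAt e i)) (≡.cong (insertAt (removeAt e i) i) eq))))
      (interpolate-last f i (λ a → sum-listing≈0 (latin i a)) (removeAt e i))

  -- The coefficient of (x₁⋯xₙ)^(q-2), equal by `lagrange-top` to (-1)ⁿ Σₐ f(a) a₁⋯aₙ. It may be
  -- zero.
  leading : ∀ {n} → Table n → Carrier
  leading f = interpolate f (replicate _ top)

  Latin⇒HasDegree : ∀ {n} {f : Table n} → Latin f → leading f ≉ 0# → HasDegree (interpolate f) (n * (q ∸ 2))
  Latin⇒HasDegree {n} latin leading≉0 =
    (replicate n top , leading≉0 ,
      ≡.trans (totalDegree-replicate n top) (≡.cong (n *_) toℕ-top)) ,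
    Latin⇒totalDegree latin

  -- Indicators and transpositions

  δ : Carrier → Carrier → Carrier
  δ s x = if does (x ≈? s) then 1# else 0#

  δ-≈ : ∀ {s x} → x ≈ s → δ s x ≈ 1#
  δ-≈ {s} {x} x≈s = reflexive (≡.cong (if_then 1# else 0#) (dec-true (x ≈? s) x≈s))

  δ-≉ : ∀ {s x} → x ≉ s → δ s x ≈ 0#
  δ-≉ {s} {x} x≉s = reflexive (≡.cong (if_then 1# else 0#) (dec-false (x ≈? s) x≉s))

  swap : Carrier → Carrier → Carrier → Carrier
  swap s t x = if does (x ≈? s) then t else if does (x ≈? t) then s else x

  swap-left : ∀ {s t x} → x ≈ s → swap s t x ≈ t
  swap-left {s} {t} {x} x≈s with x ≈? s
  ... | yes _   = refl
  ... | no  x≉s = contradiction x≈s x≉s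

  swap-right : ∀ {s t x} → x ≈ t → swap s t x ≈ s
  swap-right {s} {t} {x} x≈t with x ≈? s | x ≈? t
  ... | yes x≈s | _       = trans (sym x≈t) x≈s
  ... | no _    | yes _   = refl
  ... | no _    | no x≉t  = contradiction x≈t x≉t

  swap-other : ∀ {s t x} → x ≉ s → x ≉ t → swap s t x ≈ x
  swap-other {s} {t} {x} x≉s x≉t with x ≈? s | x ≈? t
  ... | yes x≈s | _       = contradiction x≈s x≉s
  ... | no _    | yes x≈t = contradiction x≈t x≉t
  ... | no _    | no _    = refl

  swap-cong : ∀ s t → Congruent _≈_ _≈_ (swap s t)
  swap-cong s t {x} {y} x≈y = by-cases (x ≈? s) (x ≈? t)
    where
    by-cases : Dec (x ≈ s) → Dec (x ≈ t) → swap s t x ≈ swap s t y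
    by-cases (yes x≈s) _         = trans (swap-left x≈s) (sym (swap-left (trans (sym x≈y) x≈s)))
    by-cases (no _)    (yes x≈t) = trans (swap-right x≈t) (sym (swap-right (trans (sym x≈y) x≈t)))
    by-cases (no x≉s)  (no x≉t)  =
      trans (swap-other x≉s x≉t) (trans x≈y (sym (swap-other (x≉s ∘ trans x≈y) (x≉t ∘ trans x≈y))))

  swap-involutive : ∀ s t x → swap s t (swap s t x) ≈ x
  swap-involutive s t x = by-cases (x ≈? s) (x ≈? t)
    where
    by-cases : Dec (x ≈ s) → Dec (x ≈ t) → swap s t (swap s t x) ≈ x
    by-cases (yes x≈s) _         = trans (swap-right (swap-left x≈s)) (sym x≈s)
    by-cases (no _)    (yes x≈t) = trans (swap-left (swap-right x≈t)) (sym x≈t)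
    by-cases (no x≉s)  (no x≉t)  =
      trans (swap-cong s t (swap-other x≉s x≉t)) (swap-other x≉s x≉t)

  swap-permutes : ∀ s t → Permutes (swap s t)
  swap-permutes s t = permutes-with-inverse _ (swap s t) (swap-cong s t) (swap-cong s t)
    (swap-involutive s t) (swap-involutive s t)

  -- The functions `φ` and `φ ∘ swap s t` differ only at `s` and `t`, and by opposite amounts.
  swap-difference : ∀ {s t} → s ≉ t → ∀ {φ} → Congruent _≈_ _≈_ φ → ∀ x →
    φ x ≈ (φ s - φ t) · (δ s x - δ t x) + φ (swap s t x)
  swap-difference {s} {t} s≉t {φ} φ-cong x = by-cases (x ≈? s) (x ≈? t)
    where
    by-cases : Dec (x ≈ s) → Dec (x ≈ t) → φ x ≈ (φ s - φ t) · (δ s x - δ t x) + φ (swap s t x)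
    by-cases (yes x≈s) _ = sym (begin
      (φ s - φ t) · (δ s x - δ t x) + φ (swap s t x)
        ≈⟨ +-cong (*-congˡ (+-cong (δ-≈ x≈s) (-‿cong (δ-≉ (λ x≈t → s≉t (trans (sym x≈s) x≈t)))))) (φ-cong (swap-left x≈s)) ⟩
      (φ s - φ t) · (1# - 0#) + φ t
        ≈⟨ +-congʳ (*-congˡ (trans (+-congˡ -0#≈0#) (+-identityʳ 1#))) ⟩
      (φ s - φ t) · 1# + φ t
        ≈⟨ +-congʳ (*-identityʳ _) ⟩
      φ s - φ t + φ t
        ≈⟨ x-y+y≈x _ _ ⟩
      φ s
        ≈⟨ φ-cong x≈s ⟨
      φ x ∎)
    by-cases (no x≉s) (yes x≈t) = sym (begin
      (φ s - φ t) · (δ s x - δ t x) + φ (swap s t x)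
        ≈⟨ +-cong (*-congˡ (+-cong (δ-≉ x≉s) (-‿cong (δ-≈ x≈t)))) (φ-cong (swap-right x≈t)) ⟩
      (φ s - φ t) · (0# - 1#) + φ s
        ≈⟨ +-congʳ (*-congˡ (+-identityˡ (- 1#))) ⟩
      (φ s - φ t) · - 1# + φ s
        ≈⟨ +-congʳ (trans (*-comm _ _) (-1*x≈-x _)) ⟩
      - (φ s - φ t) + φ s
        ≈⟨ +-comm _ _ ⟩
      φ s - (φ s - φ t)
        ≈⟨ x-[x-y]≈y _ _ ⟩
      φ t
        ≈⟨ φ-cong x≈t ⟨
      φ x ∎)
    by-cases (no x≉s) (no x≉t) = sym (begin
      (φ s - φ t) · (δ s x - δ t x) + φ (swap s t x)
        ≈⟨ +-cong (*-congˡ (+-cong (δ-≉ x≉s) (-‿cong (δ-≉ x≉t)))) (φ-cong (swap-other x≉s x≉t)) ⟩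
      (φ s - φ t) · (0# - 0#) + φ x
        ≈⟨ +-congʳ (trans (*-congˡ (-‿inverseʳ 0#)) (zeroʳ _)) ⟩
      0# + φ x
        ≈⟨ +-identityˡ _ ⟩
      φ x ∎)

  -- Up to sign, leading (δ s ∘ f) is the sum of the products of coordinates
  -- over the points where f takes the value s.
  record Unbalanced (n : ℕ) : Set (c ⊔ ℓ) where
    field
      table      : Table n
      latin      : Latin table
      s t        : Carrier
      s≉t        : s ≉ t
      unbalanced : leading (λ x → δ s (table x) - δ t (table x)) ≉ 0#

  -- Swapping the values s and t changes leading (φ ∘ f) by the nonzero
  -- amount (φ s − φ t) · leading (δ s ∘ f − δ t ∘ f), so φ ∘ f and
  -- φ ∘ swap s t ∘ f cannot both have leading coefficient zero.
  relabel : ∀ {n} (U : Unbalanced n) → let open Unbalanced U in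
    ∀ {φ} → Congruent _≈_ _≈_ φ → φ s ≉ φ t →
    ∃[ ρ ] (Permutes ρ × leading (λ x → φ (ρ (table x))) ≉ 0#)
  relabel {n} U {φ} φ-cong φs≉φt = decide (leading (φ ∘ table) ≈? 0#)
    where
    open Unbalanced U
    decide : Dec (leading (φ ∘ table) ≈ 0#) → ∃[ ρ ] (Permutes ρ × leading (λ x → φ (ρ (table x))) ≉ 0#)
    decide (no ≉0)  = id , permutes-with-inverse id id id id (λ _ → refl) (λ _ → refl) , ≉0
    decide (yes ≈0) = swap s t , swap-permutes s t , λ swapped≈0 → *-nonZero (-≉0 φs≉φt) unbalanced (begin
      (φ s - φ t) · D                                              ≈⟨ +-identityʳ _ ⟨
      (φ s - φ t) · D + 0#                                         ≈⟨ +-congˡ swapped≈0 ⟨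
      (φ s - φ t) · D + leading (λ x → φ (swap s t (table x)))     ≈⟨ interpolate-linear (φ s - φ t) _ _ (replicate n top) ⟨
      leading (λ x → (φ s - φ t) · (δ s (table x) - δ t (table x)) + φ (swap s t (table x)))
        ≈⟨ interpolate-cong (λ x → swap-difference s≉t φ-cong (table x)) (replicate n top) ⟨
      leading (φ ∘ table)                                          ≈⟨ ≈0 ⟩
      0#                                                           ∎)
      where
      D = leading (λ x → δ s (table x) - δ t (table x))

  -- Raising the dimension.

  Latin-∘ : ∀ {n} {f : Table n} {ρ} → Permutes ρ → Latin f → Latin (ρ ∘ f)
  Latin-∘ {zero}  ρ-perm latin     = tt
  Latin-∘ {suc n} ρ-perm latin i a = permutes-∘ (latin i a) ρ-perm

  extend : ∀ {n} → (Carrier → Carrier) → Table n → Table (suc n)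
  extend π f (k ∷ x) = π (elem k) - f x

  -- A line in the new direction is `π` followed by a translation; a line in an old direction is a
  -- line of `f` followed by a reflection v ↦ c - v.
  extend-Latin : ∀ {n} {π} {f : Table n} → Permutes π → Latin f → Latin (extend π f)
  extend-Latin {f = f} π-perm latin zero a =
    permutes-∘ (permutes-∘ elem-bijective π-perm) (+-permutes (- f a))
  extend-Latin {suc n} {π} π-perm latin (suc i) (k ∷ a) =
    permutes-∘ (latin i a) (minus-permutes (π (elem k)))

  -- The indicator selects the `l` with π(elem l) = y + v. As `π` is an involution, this means elem
  -- l = π(y + v), and the weight there is -elem l.
  lagrange-top-δ : ∀ {π} → Congruent _≈_ _≈_ π → (∀ x → π (π x) ≈ x) → ∀ y v →
    sum (λ l → lagrange top l · δ y (π (elem l) - v)) ≈ - π (y + v)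
  lagrange-top-δ {π} π-cong π-inv y v = begin
    sum (λ l → lagrange top l · δ y (π (elem l) - v))
      ≈⟨ sum-single (λ l → lagrange top l · δ y (π (elem l) - v)) l₀ off ⟩
    lagrange top l₀ · δ y (π (elem l₀) - v)
      ≈⟨ *-cong (lagrange-top l₀) (δ-≈ hit) ⟩
    - elem l₀ · 1#
      ≈⟨ *-identityʳ _ ⟩
    - elem l₀
      ≈⟨ -‿cong (elem-index _) ⟩
    - π (y + v) ∎
    where
    l₀ = index (π (y + v))
    hit : π (elem l₀) - v ≈ y
    hit = trans (+-congʳ (trans (π-cong (elem-index _)) (π-inv (y + v)))) (x+y-y≈x y v)
    off : ∀ l → l ≢ l₀ → lagrange top l · δ y (π (elem l) - v) ≈ 0#
    off l l≢ = trans (*-congˡ (δ-≉ (λ eq → l≢ (elem-injective (begin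
      elem l                    ≈⟨ π-inv (elem l) ⟨
      π (π (elem l))            ≈⟨ π-cong (x-y+y≈x (π (elem l)) v) ⟨
      π (π (elem l) - v + v)    ≈⟨ π-cong (+-congʳ eq) ⟩
      π (y + v)                 ≈⟨ elem-index _ ⟨
      elem l₀                   ∎))))) (zeroʳ _)

  -- Summing over the new coordinate first leaves a function of `f x` alone, to which `relabel`
  -- applies one dimension lower. The sign in `lagrange-top-δ` reverses the order of `y` and `z`.
  leading-extend : ∀ {n} {π} → Congruent _≈_ _≈_ π → (∀ x → π (π x) ≈ x) → ∀ (f : Table n) y z →
    leading (λ x → δ y (extend π f x) - δ z (extend π f x)) ≈ leading (λ x → π (z + f x) - π (y + f x))
  leading-extend {n} {π} π-cong π-inv f y z = begin
    sum (λ l → lagrange top l · leading (λ x → δ y (π (elem l) - f x) - δ z (π (elem l) - f x)))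
      ≈⟨ interpolate-sum (lagrange top) (λ l x → δ y (π (elem l) - f x) - δ z (π (elem l) - f x)) (replicate n top) ⟨
    leading (λ x → sum (λ l → lagrange top l · (δ y (π (elem l) - f x) - δ z (π (elem l) - f x))))
      ≈⟨ interpolate-cong (λ x → collapse (f x)) (replicate n top) ⟩
    leading (λ x → π (z + f x) - π (y + f x)) ∎
    where
    collapse : ∀ v → sum (λ l → lagrange top l · (δ y (π (elem l) - v) - δ z (π (elem l) - v))) ≈ π (z + v) - π (y + v)
    collapse v = begin
      sum (λ l → lagrange top l · (A l - B l))
        ≈⟨ x+y-y≈x _ _ ⟨
      sum (λ l → lagrange top l · (A l - B l)) + sum (λ l → lagrange top l · B l) - sum (λ l → lagrange top l · B l)
        ≈⟨ +-congʳ (∑-distrib-+ (λ l → lagrange top l · (A l - B l)) (λ l → lagrange top l · B l)) ⟨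
      sum (λ l → lagrange top l · (A l - B l) + lagrange top l · B l) - sum (λ l → lagrange top l · B l)
        ≈⟨ +-congʳ (sum-cong-≋ {q} (λ l → trans (sym (distribˡ _ _ _)) (*-congˡ (x-y+y≈x _ _)))) ⟩
      sum (λ l → lagrange top l · A l) - sum (λ l → lagrange top l · B l)
        ≈⟨ +-cong (lagrange-top-δ π-cong π-inv y v) (-‿cong (lagrange-top-δ π-cong π-inv z v)) ⟩
      - π (y + v) - - π (z + v)
        ≈⟨ trans (+-congˡ (-‿involutive _)) (+-comm _ _) ⟩
      π (z + v) - π (y + v) ∎
      where
      A B : Fin q → Carrier
      A l = δ y (π (elem l) - v)
      B l = δ z (π (elem l) - v)

  -- In dimension zero `leading` is the value at the only point, so one attained and one missed
  -- value are already unbalanced.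
  constant-table : Unbalanced 0
  constant-table = record
    { table = λ _ → 1#
    ; latin = tt
    ; s = 1#
    ; t = 0#
    ; s≉t = 1≉0
    ; unbalanced = λ eq → 1≉0 (begin
        1#                  ≈⟨ +-identityʳ 1# ⟨
        1# + 0#             ≈⟨ +-congˡ -0#≈0# ⟨
        1# - 0#             ≈⟨ +-cong (δ-≈ refl) (-‿cong (δ-≉ 1≉0)) ⟨
        δ 1# 1# - δ 0# 1#   ≈⟨ eq ⟩
        0#                  ∎)
    }

  module _ (2≉0 : 1# + 1# ≉ 0#) where

    -- With d = t − s and u ∉ {0, d, −d}, the transposition π of 0 and u has
    -- π(u) − π(0) = −u but π(u + d) − π(d) = u, and these differ since 2u ≠ 0.
    grow : ∀ {n} → Unbalanced n → Unbalanced (suc n)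
    grow {n} U = record
      { table = extend π (ρ ∘ table)
      ; latin = extend-Latin {f = ρ ∘ table} (swap-permutes 0# u) (Latin-∘ {f = table} ρ-permutes latin)
      -- With this pair `leading-extend` yields φ(v) = π(u - s + v) - π(-s + v). The shift by -s
      -- makes the arguments of `π` equal to u and 0 at v = s, and to u + d and d at v = t.
      ; s = - s
      ; t = u - s
      ; s≉t = λ eq → u≉0 (begin
          u             ≈⟨ x-y+y≈x u s ⟨
          u - s + s     ≈⟨ +-congʳ eq ⟨
          - s + s       ≈⟨ -‿inverseˡ s ⟩
          0#            ∎)
      ; unbalanced = ρ-leading ∘ trans (sym (leading-extend (swap-cong 0# u) (swap-involutive 0# u) (ρ ∘ table) (- s) (u - s)))
      }
      where
      open Unbalanced U
      d = t - s
      d≉0 : d ≉ 0#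
      d≉0 = -≉0 (s≉t ∘ sym)
      chosen = avoid-three 0# d (- d)
      u = proj₁ chosen
      u≉0 = proj₁ (proj₂ chosen)
      u≉d = proj₁ (proj₂ (proj₂ chosen))
      u≉-d = proj₂ (proj₂ (proj₂ chosen))
      π = swap 0# u
      φ : Carrier → Carrier
      φ v = π (u - s + v) - π (- s + v)
      φ-cong : Congruent _≈_ _≈_ φ
      φ-cong eq = +-cong (swap-cong 0# u (+-congˡ eq)) (-‿cong (swap-cong 0# u (+-congˡ eq)))
      φs : φ s ≈ - u
      φs = trans (+-cong (swap-right (x-y+y≈x u s)) (-‿cong (swap-left (-‿inverseˡ s)))) (+-identityˡ _)
      u-s+t : u - s + t ≈ u + d
      u-s+t = trans (+-assoc _ _ _) (+-congˡ (+-comm _ _))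
      φt : φ t ≈ u
      φt = begin
        π (u - s + t) - π (- s + t)   ≈⟨ +-cong (swap-cong 0# u u-s+t) (-‿cong (swap-cong 0# u (+-comm (- s) t))) ⟩
        π (u + d) - π d               ≈⟨ +-cong (swap-other (u≉-d ∘ +-inverseˡ-unique u d) (d≉0 ∘ +-identityʳ-unique u d))
                                               (-‿cong (swap-other d≉0 (u≉d ∘ sym))) ⟩
        u + d - d                     ≈⟨ x+y-y≈x u d ⟩
        u                             ∎
      φs≉φt : φ s ≉ φ t
      φs≉φt eq = *-nonZero 2≉0 u≉0 (begin
        (1# + 1#) · u       ≈⟨ distribʳ u 1# 1# ⟩
        1# · u + 1# · u     ≈⟨ +-cong (*-identityˡ u) (*-identityˡ u) ⟩
        u + u               ≈⟨ +-congʳ (trans (sym φt) (trans (sym eq) φs)) ⟩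
        - u + u             ≈⟨ -‿inverseˡ u ⟩
        0#                  ∎)
      relabelled = relabel U φ-cong φs≉φt
      ρ = proj₁ relabelled
      ρ-permutes = proj₁ (proj₂ relabelled)
      ρ-leading = proj₂ (proj₂ relabelled)

    unbalanced-Latin : ∀ n → Unbalanced n
    unbalanced-Latin zero    = constant-table
    unbalanced-Latin (suc n) = grow (unbalanced-Latin n)

    -- A last relabelling, with `φ` the identity, turns the imbalance into a nonzero leading
    -- coefficient of the table itself.
    exists-LPP : ∀ n → ∃[ f ] (IsLPP {n} f × HasDegree {n} f (n * (q ∸ 2)))
    exists-LPP n with ρ , ρ-permutes , leading≉0 ← relabel (unbalanced-Latin n) {φ = id} id (Unbalanced.s≉t (unbalanced-Latin n)) =
      interpolate g , Latin⇒IsLPP {f = g} g-latin , Latin⇒HasDegree {f = g} g-latin leading≉0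
      where
      open Unbalanced (unbalanced-Latin n)
      g : Table n
      g = ρ ∘ table
      g-latin : Latin g
      g-latin = Latin-∘ {f = table} ρ-permutes latin

-- Powers of odd primes are odd.

odd-prime : ∀ {p} → Prime p → 3 ≤ p → ¬ 2 ∣ p
odd-prime p-prime 3≤p 2∣p with prime⇒irreducible p-prime 2∣p
... | inj₂ ≡.refl = contradiction 3≤p λ { (s≤s (s≤s ())) }

odd-^ : ∀ {p} → ¬ 2 ∣ p → ∀ r → ¬ 2 ∣ p ^ r
odd-^ 2∤p zero 2∣1 with ∣1⇒≡1 2∣1
... | ()
odd-^ {p} 2∤p (suc r) 2∣p^r with euclidsLemma p (p ^ r) prime[2] 2∣p^r
... | inj₁ 2∣p  = 2∤p 2∣p
... | inj₂ 2∣pʳ = odd-^ 2∤p r 2∣pʳ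

mainTheorem13 : ∀ {c ℓ} (p r q : ℕ) → Prime p → 3 ≤ p → q ≡ p ^ r → 3 < q →
    (F : CommutativeRing c ℓ) → IsFiniteField F q →
    (n : ℕ) → 1 ≤ n →
    let open ReducedPolynomials F q in
    ∃[ f ] IsLPP {n} f × HasDegree {n} f (n * (q ∸ 2))
mainTheorem13 p r q p-prime 3≤p q≡pʳ 3<q F isFF n _ = exists-LPP (odd⇒2≉0 2∤q) n
  where
  open FiniteField F q 3<q isFF
  2∤q : ¬ 2 ∣ q
  2∤q = ≡.subst (λ k → ¬ 2 ∣ k) (≡.sym q≡pʳ) (odd-^ (odd-prime p-prime 3≤p) r)
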